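{- Let $\mathcal{M}=(S,A,\Delta,T)$ be a \~pMDP that is isomorphic to its MEC-quotient $\mathcal{M}_{/\mathrm{MEC}}$, with graph $(V,E)$. Then for every graph-preserving valuation $\mathsf{val}$ and every $(s,a)\in S\times A$ with $(s,a)\trianglelefteq (sE\setminus\{(s,a)\})$, we have $\max_\sigma \mathbb{P}^{s}_{\mathcal{M}^\sigma_{\mathsf{val}}}[\Diamond\mathit{fin}]=\max_{\sigma'}\mathbb{P}^{s}_{\mathcal{N}^{\sigma'}_{\mathsf{val}}}[\Diamond\mathit{fin}]$, where $\mathcal{N}=(S,A,\Delta\setminus\{(s,a,s')\in\Delta\mid s'\in S\},T)$ is obtained by removing all transitions of the pair $(s,a)$.
   Context: A \~pMDP is $(S,A,\Delta,T)$ with finite states $S$, actions $A$, targets $T=\{\mathit{fin},\mathit{fail}\}$ (no outgoing transitions), and transitions $\Delta\subseteq(S\setminus T)\times A\times S$. Graph: $V=S\cup((S\setminus T)\times A)$, edge $((s,a),s')$ iff $(s,a,s')\in\Delta$, edge $(s,(s,a))$ iff $(s,a,s')\in\Delta$ for some $s'\ne\mathit{fail}$; $vE$ is the successor set. A graph-preserving valuation $\mathsf{val}$ assigns to each state-action pair a full-support probability distribution on its $\Delta$-successors. A strategy and $\mathsf{val}$ induce a Markov chain $\mathcal{M}^\sigma_{\mathsf{val}}$; $\mathbb{P}^s[\Diamond\mathit{fin}]$ is the probability of reaching $\mathit{fin}$ from $s$. Values: $\mathrm{Rew}^*_{\mathsf{val}}(s)=\max_\sigma\mathbb{P}^s[\Diamond\mathit{fin}]$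 for states, and for $(s,a)$, $\mathrm{Rew}^*_{\mathsf{val}}((s,a))=\sum_{s'}\mathsf{val}_{(s,a)}(s')\mathrm{Rew}^*_{\mathsf{val}}(s')$. For $v\in V,W\subseteq V$: $v\trianglelefteq W$ iff for every graph-preserving $\mathsf{val}$ some $w\in W$ has $\mathrm{Rew}^*_{\mathsf{val}}(v)\le\mathrm{Rew}^*_{\mathsf{val}}(w)$. A sub-MDP is a pair $(P,B)$ with $P\subseteq S$, $B$ a set of pairs $(p,a)$ with $(p,(p,a))\in E$, such that every $p\in P$ has some $(p,a)\in B$ and every $\Delta$-successor of every $(p,a)\in B$ lies in $P$. An end component is a sub-MDP whose induced subgraph on $P\cup B$ is strongly connected; a MEC is an end component $(P,B)$ such that no other end component $(P',B')$ has $B\subseteq B'$. For $s\in S$, $[s]$ denotes $P$ if $s$ lies in a (unique) MEC $(P,B)$ and $\{s\}$ otherwise. The MEC-quotient is $\mathcal{M}_{/\mathrm{MEC}}=(S',A,\Delta',T')$ with $S'=\{[s]\mid s\in S\}$, $T'=\{[t]\mid t\in T\}$ and $\Delta'=\{([s],a,[s'])\mid (s,a,s')\in\Delta,\ [s]\neq[s']\}$. -}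

module Defs where

open import Level using (0ℓ)
open import Algebra.Bundles using (CommutativeRing)
open import Data.Bool.Base using (if_then_else_)
open import Data.Fin.Base using (Fin; toℕ; finToFun)
open import Data.Fin.Properties using (_≟_; all?; any?)
open import Data.Fin.Subset using (Subset; _∈_; _∉_; _⊆_; Nonempty) renaming (⊥ to ∅)
open import Data.Fin.Subset.Properties using (nonempty?; ∉⊥)
open import Data.List.Base using (List; allFin; filter)
import Data.List.Base as List
import Data.List.Extrema as Extrema
open import Data.Nat.Base using (ℕ; zero; suc; _^_)
open import Data.Product.Base using (∃; ∃-syntax; _×_; _,_; proj₁; proj₂)
open import Data.Sum.Base using (_⊎_; inj₁; inj₂)
open import Data.Vec.Base using (Vec; []; _∷_)
open import Function.Base using (_∘_)
open import Function.Bundles using (Inverse; _↔_; _⇔_)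
open import Relation.Binary.Bundles using (Setoid; TotalOrder)
open import Relation.Binary.Construct.Closure.ReflexiveTransitive using (Star)
open import Relation.Binary.Core using (Rel)
open import Relation.Binary.PropositionalEquality.Core using (_≡_; _≢_)
import Relation.Binary.PropositionalEquality.Core as ≡
import Relation.Binary.PropositionalEquality.Properties as ≡
import Relation.Binary.Reasoning.PartialOrder as ≤-Reasoning
import Relation.Binary.Structures as Structures
open import Relation.Nullary.Decidable.Core using (Dec; does; yes; no; _×-dec_; _→-dec_)
open import Relation.Nullary.Negation.Core using (¬_; contradiction)
open import Relation.Unary using (Pred; Satisfiable; _≐_)

import Algebra.Properties.CommutativeMonoid.Sum
import Algebra.Properties.Semiring.Sum

------------------------------------------------------------------------
-- Real numbers

-- The classical axioms of ℝ, which determine it up to isomorphism: a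
-- Dedekind-complete, (decidably) totally ordered field.  Everything below
-- is stated for an arbitrary model of them.

record RealField : Set₁ where
  infix 4 _≤_ _<_
  field
    commutativeRing : CommutativeRing 0ℓ 0ℓ

  open CommutativeRing commutativeRing public

  field
    _≤_             : Rel Carrier 0ℓ
    isDecTotalOrder : Structures.IsDecTotalOrder _≈_ _≤_
    +-monoˡ-≤       : ∀ {x y} z → x ≤ y → x + z ≤ y + z
    *-nonNeg        : ∀ {x y} → 0# ≤ x → 0# ≤ y → 0# ≤ x * y
    0≉1             : ¬ 0# ≈ 1#
    inverse         : ∀ {x} → ¬ x ≈ 0# → ∃[ y ] x * y ≈ 1#

  UpperBound : Pred Carrier 0ℓ → Pred Carrier 0ℓ
  UpperBound X b = ∀ {x} → X x → x ≤ b

  field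
    complete : (X : Pred Carrier 0ℓ) → Satisfiable X → Satisfiable (UpperBound X) →
               ∃[ l ] UpperBound X l × (∀ {b} → UpperBound X b → l ≤ b)

  _<_ : Rel Carrier 0ℓ
  x < y = x ≤ y × ¬ x ≈ y

  open Structures.IsDecTotalOrder isDecTotalOrder public
    using (isTotalOrder)
    renaming ( refl to ≤-refl; trans to ≤-trans; antisym to ≤-antisym
             ; reflexive to ≤-reflexive; total to ≤-total
             ; _≟_ to _≈?_; _≤?_ to _≤?_)

  totalOrder : TotalOrder 0ℓ 0ℓ 0ℓ
  totalOrder = record { isTotalOrder = isTotalOrder }

  open TotalOrder totalOrder public using (poset)
  open Extrema totalOrder public using (max)
  open Algebra.Properties.Semiring.Sum semiring public

  sup : (X : Pred Carrier 0ℓ) → Satisfiable X → Satisfiable (UpperBound X) → Carrier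
  sup X ne bd = proj₁ (complete X ne bd)

------------------------------------------------------------------------
-- Finite Markov chains and reachability probabilities

module _ (ℝ : RealField) where
  open RealField ℝ

  -- A state may have no outgoing transitions at all, in which case its row
  -- is zero and every run stops there.

  record MarkovChain (n : ℕ) : Set where
    field
      μ        : Fin n → Fin n → Carrier
      μ-nonNeg : ∀ s t → 0# ≤ μ s t
      μ-row    : ∀ s → (∑[ t < n ] μ s t ≈ 1#) ⊎ (∀ t → μ s t ≈ 0#)

  module _ {n : ℕ} where

    ∑paths : ∀ k → (Vec (Fin n) k → Carrier) → Carrier
    ∑paths zero    f = f []
    ∑paths (suc k) f = ∑[ t < n ] ∑paths k (f ∘ (t ∷_))

  module _ {n : ℕ} (C : MarkovChain n) (goal : Fin n) where
    open MarkovChain C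

    -- The probability of the cylinder of the path fragment s ∷ π if this
    -- fragment visits goal at its last state and not before, and 0
    -- otherwise.  The cylinders of the former kind partition ◇ goal.

    hitWeight : ∀ {k} → Fin n → Vec (Fin n) k → Carrier
    hitWeight s []      = if does (s ≟ goal) then 1# else 0#
    hitWeight s (t ∷ π) = if does (s ≟ goal) then 0# else μ s t * hitWeight t π

    hitAt : ℕ → Fin n → Carrier
    hitAt k s = ∑paths k (hitWeight s)

    hitBefore : ℕ → Fin n → Carrier
    hitBefore k s = ∑[ j < k ] hitAt (toℕ j) s

    HitBefore : Fin n → Pred Carrier 0ℓ
    HitBefore s x = ∃[ k ] x ≈ hitBefore k s

    private
      open ≤-Reasoning poset

      +-mono : ∀ {x y u v} → x ≤ y → u ≤ v → x + u ≤ y + v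
      +-mono {x} {y} {u} {v} x≤y u≤v = begin
        x + u ≤⟨ +-monoˡ-≤ u x≤y ⟩
        y + u ≈⟨ +-comm y u ⟩
        u + y ≤⟨ +-monoˡ-≤ y u≤v ⟩
        v + y ≈⟨ +-comm v y ⟩
        y + v ∎

      sum-mono : ∀ {m} {f g : Fin m → Carrier} → (∀ i → f i ≤ g i) → sum f ≤ sum g
      sum-mono {zero}  f≤g = ≤-refl
      sum-mono {suc m} f≤g = +-mono (f≤g Fin.zero) (sum-mono (f≤g ∘ Fin.suc))

      sum-zero : ∀ {m} {f : Fin m → Carrier} → (∀ i → f i ≈ 0#) → sum f ≈ 0#
      sum-zero {m} f≈0 = trans (sum-cong-≋ f≈0) (sum-replicate-zero m)

      0≤1 : 0# ≤ 1#
      0≤1 with ≤-total 0# 1#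
      ... | inj₁ p = p
      ... | inj₂ 1≤0 = contradiction (≤-antisym 0≤1′ 1≤0) 0≉1
        where
        open import Algebra.Properties.Ring ring using (-‿distribˡ-*; -‿involutive)
        0≤-1 : 0# ≤ - 1#
        0≤-1 = begin
          0#         ≈⟨ sym (-‿inverseʳ 1#) ⟩
          1# + - 1#  ≤⟨ +-monoˡ-≤ (- 1#) 1≤0 ⟩
          0# + - 1#  ≈⟨ +-identityˡ (- 1#) ⟩
          - 1#       ∎
        0≤1′ : 0# ≤ 1#
        0≤1′ = begin
          0#               ≤⟨ *-nonNeg 0≤-1 0≤-1 ⟩
          - 1# * - 1#      ≈⟨ sym (-‿distribˡ-* 1# (- 1#)) ⟩
          - (1# * - 1#)    ≈⟨ -‿cong (*-identityˡ (- 1#)) ⟩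
          - (- 1#)         ≈⟨ -‿involutive 1# ⟩
          1#               ∎

      *-monoʳ : ∀ {c x} → 0# ≤ c → x ≤ 1# → c * x ≤ c
      *-monoʳ {c} {x} 0≤c x≤1 = begin
        c * x                        ≈⟨ sym (+-identityˡ (c * x)) ⟩
        0# + c * x                   ≤⟨ +-monoˡ-≤ (c * x) (*-nonNeg 0≤c 0≤1-x) ⟩
        c * (1# + - x) + c * x       ≈⟨ sym (distribˡ c (1# + - x) x) ⟩
        c * ((1# + - x) + x)         ≈⟨ *-congˡ (+-assoc 1# (- x) x) ⟩
        c * (1# + (- x + x))         ≈⟨ *-congˡ (+-congˡ (-‿inverseˡ x)) ⟩
        c * (1# + 0#)                ≈⟨ *-congˡ (+-identityʳ 1#) ⟩
        c * 1#                       ≈⟨ *-identityʳ c ⟩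
        c                            ∎
        where
        0≤1-x : 0# ≤ 1# + - x
        0≤1-x = begin
          0#         ≈⟨ sym (-‿inverseʳ x) ⟩
          x + - x    ≤⟨ +-monoˡ-≤ (- x) x≤1 ⟩
          1# + - x   ∎

      ∑paths-* : ∀ k c (f : Vec (Fin n) k → Carrier) →
                 ∑paths k (λ π → c * f π) ≈ c * ∑paths k f
      ∑paths-* zero    c f = refl
      ∑paths-* (suc k) c f = trans
        (sum-cong-≋ (λ t → ∑paths-* k c (f ∘ (t ∷_))))
        (sym (*-distribˡ-sum c (λ t → ∑paths k (f ∘ (t ∷_)))))

      ∑paths-0 : ∀ k → ∑paths {n} k (λ _ → 0#) ≈ 0#
      ∑paths-0 zero    = refl
      ∑paths-0 (suc k) = sum-zero {n} (λ _ → ∑paths-0 k)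

      row≤1 : ∀ s → ∑[ t < n ] μ s t ≤ 1#
      row≤1 s with μ-row s
      ... | inj₁ e = ≤-reflexive e
      ... | inj₂ z = ≤-trans (≤-reflexive (sum-zero z)) 0≤1

    hitBefore≤1 : ∀ k s → hitBefore k s ≤ 1#
    hitBefore≤1 zero    s = 0≤1
    hitBefore≤1 (suc k) s with s ≟ goal
    ... | yes _ = ≤-reflexive
      (trans (+-congˡ (sum-zero {k} (λ j → ∑paths-0 (suc (toℕ j))))) (+-identityʳ 1#))
    ... | no  _ = begin
      0# + (∑[ j < k ] ∑[ t < n ] ∑paths (toℕ j) (λ π → μ s t * hitWeight t π))
        ≈⟨ +-identityˡ _ ⟩
      (∑[ j < k ] ∑[ t < n ] ∑paths (toℕ j) (λ π → μ s t * hitWeight t π))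
        ≈⟨ sum-cong-≋ {k} (λ j → sum-cong-≋ {n} (λ t → ∑paths-* (toℕ j) (μ s t) (hitWeight t))) ⟩
      (∑[ j < k ] ∑[ t < n ] (μ s t * hitAt (toℕ j) t))
        ≈⟨ ∑-comm {k} {n} (λ j t → μ s t * hitAt (toℕ j) t) ⟩
      (∑[ t < n ] ∑[ j < k ] (μ s t * hitAt (toℕ j) t))
        ≈⟨ sum-cong-≋ {n} (λ t → sym (*-distribˡ-sum {k} (μ s t) (λ j → hitAt (toℕ j) t))) ⟩
      (∑[ t < n ] (μ s t * hitBefore k t))
        ≤⟨ sum-mono (λ t → *-monoʳ (μ-nonNeg s t) (hitBefore≤1 k t)) ⟩
      (∑[ t < n ] μ s t)
        ≤⟨ row≤1 s ⟩
      1# ∎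

    -- ℙˢ[◇ goal], by countable additivity over the cylinders above: the sum
    -- of a series of non-negative terms is the supremum of its partial sums.

    ℙ[◇] : Fin n → Carrier
    ℙ[◇] s = sup (HitBefore s) (_ , 0 , refl)
                 (1# , λ (k , x≈) → ≤-trans (≤-reflexive x≈) (hitBefore≤1 k s))

------------------------------------------------------------------------
-- p̃MDPs and their graphs

-- Δ s a is the set of Δ-successors of (s , a), so that (s,a,s′) ∈ Δ is
-- rendered as s′ ∈ Δ s a.

record PMDP : Set where
  field
    |S| |A| : ℕ

  S : Set
  S = Fin |S|

  A : Set
  A = Fin |A|

  field
    fin fail   : S
    fin≢fail   : fin ≢ fail
    Δ          : S → A → Subset |S|
    Δ-fin      : ∀ {a t} → t ∉ Δ fin a
    Δ-fail     : ∀ {a t} → t ∉ Δ fail a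

module _ (M : PMDP) where
  open PMDP M

  -- The pairs (t , a) with t a target also get a vertex; having no
  -- successors in Δ, they are isolated in the graph.

  data Vertex : Set where
    state : S → Vertex
    pair  : S → A → Vertex

  data Edge : Vertex → Vertex → Set where
    choose : ∀ {s a t} → t ∈ Δ s a → t ≢ fail → Edge (state s) (pair s a)
    move   : ∀ {s a t} → t ∈ Δ s a → Edge (pair s a) (state t)

  ----------------------------------------------------------------------
  -- End components

  record Sub : Set where
    constructor _,,_
    field
      P : Subset |S|
      B : S → Subset |A|

  open Sub

  infix 4 _≈ₛ_
  _≈ₛ_ : Rel Sub 0ℓ
  X ≈ₛ Y = P X ≡ P Y × (∀ s → B X s ≡ B Y s)

  record IsSubMDP (X : Sub) : Set where
    field
      B-state  : ∀ {p a} → a ∈ B X p → p ∈ P X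
      B-edge   : ∀ {p a} → a ∈ B X p → Edge (state p) (pair p a)
      B-action : ∀ {p} → p ∈ P X → Nonempty (B X p)
      B-closed : ∀ {p a t} → a ∈ B X p → t ∈ Δ p a → t ∈ P X

  data InSub (X : Sub) : Vertex → Set where
    state : ∀ {p}   → p ∈ P X   → InSub X (state p)
    pair  : ∀ {p a} → a ∈ B X p → InSub X (pair p a)

  InducedEdge : Sub → Rel Vertex 0ℓ
  InducedEdge X u v = InSub X u × InSub X v × Edge u v

  StronglyConnected : Sub → Set
  StronglyConnected X = ∀ {u v} → InSub X u → InSub X v → Star (InducedEdge X) u v

  IsEndComponent : Sub → Set
  IsEndComponent X = IsSubMDP X × StronglyConnected X

  IsMEC : Sub → Set
  IsMEC X = IsEndComponent X ×
            (∀ Y → IsEndComponent Y → ¬ Y ≈ₛ X → ¬ (∀ s → B X s ⊆ B Y s))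

  ----------------------------------------------------------------------
  -- The MEC-quotient

  [_] : S → Pred S 0ℓ
  [ s ] t = (∃[ X ] IsMEC X × s ∈ P X × t ∈ P X)
          ⊎ (¬ (∃[ X ] IsMEC X × s ∈ P X)) × t ≡ s

  -- The set { [ s ] ∣ s ∈ S }: an element [ s ] is represented by s, and
  -- equality is (extensional) equality of the sets [ s ].

  classes : Setoid 0ℓ 0ℓ
  classes = record
    { Carrier       = S
    ; _≈_           = λ s t → [ s ] ≐ [ t ]
    ; isEquivalence = record
      { refl  = (λ x → x) , (λ x → x)
      ; sym   = λ (f , g) → g , f
      ; trans = λ (f , g) (h , k) → (λ x → h (f x)) , (λ x → g (k x))
      }
    }

-- The data of a p̃MDP over a state space whose equality may be a quotient.

record TransitionStructure : Set₁ where
  field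
    states   : Setoid 0ℓ 0ℓ
    actions  : Set
    fin fail : Setoid.Carrier states
    Δ        : Setoid.Carrier states → actions → Setoid.Carrier states → Set

  open Setoid states public using (_≈_)

module _ (M : PMDP) where
  open PMDP M

  structure : TransitionStructure
  structure = record
    { states  = ≡.setoid S
    ; actions = A
    ; fin     = fin
    ; fail    = fail
    ; Δ       = λ s a t → t ∈ Δ s a
    }

  MEC-quotient : TransitionStructure
  MEC-quotient = record
    { states  = classes M
    ; actions = A
    ; fin     = fin
    ; fail    = fail
    ; Δ       = λ x a y → ∃[ s ] ∃[ t ] s ~ x × t ~ y × t ∈ Δ s a × ¬ s ~ t
    }
    where open Setoid (classes M) using () renaming (_≈_ to _~_)

infix 4 _≅_
record _≅_ (X Y : TransitionStructure) : Set where
  private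
    module X = TransitionStructure X
    module Y = TransitionStructure Y
  field
    onStates  : Inverse X.states Y.states
    onActions : X.actions ↔ Y.actions

  open Inverse onStates  using () renaming (to to f)
  open Inverse onActions using () renaming (to to g)

  field
    fin-preserved  : f X.fin Y.≈ Y.fin
    fail-preserved : f X.fail Y.≈ Y.fail
    Δ-preserved    : ∀ s a t → X.Δ s a t ⇔ Y.Δ (f s) (g a) (f t)

------------------------------------------------------------------------
-- Removing all transitions of a state-action pair

module _ (M : PMDP) where
  open PMDP M

  isPair? : (s : S) (a : A) (s′ : S) (a′ : A) → Dec (s′ ≡ s × a′ ≡ a)
  isPair? s a s′ a′ = s′ ≟ s ×-dec a′ ≟ a

  remove : S → A → PMDP
  remove s a = record
    { |S|      = |S|
    ; |A|      = |A|
    ; fin      = fin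
    ; fail     = fail
    ; fin≢fail = fin≢fail
    ; Δ        = Δ∖
    ; Δ-fin    = λ {b} → Δ∖-out fin b Δ-fin
    ; Δ-fail   = λ {b} → Δ∖-out fail b Δ-fail
    }
    where
    Δ∖ : S → A → Subset |S|
    Δ∖ s′ a′ = if does (isPair? s a s′ a′) then ∅ else Δ s′ a′

    Δ∖-out : ∀ s′ a′ {t} → t ∉ Δ s′ a′ → t ∉ Δ∖ s′ a′
    Δ∖-out s′ a′ t∉ with s′ ≟ s | a′ ≟ a
    ... | yes _ | yes _ = ∉⊥
    ... | yes _ | no  _ = t∉
    ... | no  _ | _     = t∉

------------------------------------------------------------------------
-- Valuations, strategies and values

module _ (ℝ : RealField) where
  open RealField ℝ

  record Valuation (M : PMDP) : Set where
    open PMDP M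
    field
      prob     : S → A → S → Carrier
      positive : ∀ {s a t} → t ∈ Δ s a → 0# < prob s a t
      outside  : ∀ {s a t} → t ∉ Δ s a → prob s a t ≈ 0#
      total    : ∀ {s a} → Nonempty (Δ s a) → ∑[ t < |S| ] prob s a t ≈ 1#

  -- The restriction of a valuation to the remaining pairs.

  restrict : (M : PMDP) (s : PMDP.S M) (a : PMDP.A M) → Valuation M → Valuation (remove M s a)
  restrict M s a val = record
    { prob     = prob′
    ; positive = λ {s′} {a′} → positive′ s′ a′
    ; outside  = λ {s′} {a′} → outside′ s′ a′
    ; total    = λ {s′} {a′} → total′ s′ a′
    }
    where
    open PMDP M using (S; A; |S|)
    open PMDP (remove M s a) using (Δ)
    open Valuation val

    prob′ : S → A → S → Carrier
    prob′ s′ a′ t = if does (isPair? M s a s′ a′) then 0# else prob s′ a′ t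

    positive′ : ∀ s′ a′ {t} → t ∈ Δ s′ a′ → 0# < prob′ s′ a′ t
    positive′ s′ a′ t∈ with s′ ≟ s | a′ ≟ a
    ... | yes _ | yes _ = contradiction t∈ ∉⊥
    ... | yes _ | no  _ = positive t∈
    ... | no  _ | _     = positive t∈

    outside′ : ∀ s′ a′ {t} → t ∉ Δ s′ a′ → prob′ s′ a′ t ≈ 0#
    outside′ s′ a′ t∉ with s′ ≟ s | a′ ≟ a
    ... | yes _ | yes _ = refl
    ... | yes _ | no  _ = outside t∉
    ... | no  _ | _     = outside t∉

    total′ : ∀ s′ a′ → Nonempty (Δ s′ a′) → ∑[ t < |S| ] prob′ s′ a′ t ≈ 1#
    total′ s′ a′ ne with s′ ≟ s | a′ ≟ a
    ... | yes _ | yes _ = contradiction (proj₂ ne) ∉⊥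
    ... | yes _ | no  _ = total ne
    ... | no  _ | _     = total ne

  module _ (M : PMDP) where
    open PMDP M

    -- Strategies are memoryless and deterministic and pick an action that
    -- has transitions wherever there is one.

    IsStrategy : Pred (S → A) 0ℓ
    IsStrategy σ = ∀ s → (∃[ a ] Nonempty (Δ s a)) → Nonempty (Δ s (σ s))

    isStrategy? : ∀ σ → Dec (IsStrategy σ)
    isStrategy? σ = all? λ s → any? (λ a → nonempty? (Δ s a)) →-dec nonempty? (Δ s (σ s))

    strategies : List (S → A)
    strategies = filter isStrategy? (List.map finToFun (allFin (|A| ^ |S|)))

    module _ (val : Valuation M) where
      open Valuation val

      induced : (S → A) → MarkovChain ℝ |S|
      induced σ = record
        { μ        = λ s → prob s (σ s)
        ; μ-nonNeg = λ s → nonNeg s (σ s)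
        ; μ-row    = λ s → row s (σ s)
        }
        where
        open import Data.Fin.Subset.Properties using (_∈?_)

        nonNeg : ∀ s a t → 0# ≤ prob s a t
        nonNeg s a t with t ∈? Δ s a
        ... | yes t∈ = proj₁ (positive t∈)
        ... | no  t∉ = ≤-reflexive (sym (outside t∉))

        row : ∀ s a → (∑[ t < |S| ] prob s a t ≈ 1#) ⊎ (∀ t → prob s a t ≈ 0#)
        row s a with nonempty? (Δ s a)
        ... | yes ne = inj₁ (total ne)
        ... | no  ¬ne = inj₂ λ t → outside λ t∈ → ¬ne (t , t∈)

      -- Including 0 does not affect the maximum, as probabilities are
      -- non-negative; the list is empty only if A is.

      maxℙ[◇fin] : S → Carrier
      maxℙ[◇fin] s = max 0# (List.map (λ σ → ℙ[◇] ℝ (induced σ) fin s) strategies)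

      Rew* : Vertex M → Carrier
      Rew* (state s)  = maxℙ[◇fin] s
      Rew* (pair s a) = ∑[ t < |S| ] (prob s a t * maxℙ[◇fin] t)

    infix 4 _⊴_
    _⊴_ : Vertex M → Pred (Vertex M) 0ℓ → Set
    v ⊴ W = (val : Valuation M) → ∃[ w ] W w × Rew* val v ≤ Rew* val w

{-# OPTIONS --safe #-}

-- A p̃MDP isomorphic to its MEC-quotient has no self-loops and no two distinct
-- states with the same class, hence no non-empty end component.  Therefore no
-- strategy has a non-empty set of states that it never leaves and never stops
-- in, and by the maximum principle every g with g(fin) ≤ 1 that is subharmonic
-- off fin for the induced chain lies below the reachability probability.  Apply
-- this to the optimal value V of 𝓜 and the strategy of 𝓝 that is greedy for V:
-- since another action at s is at least as good as a, V is subharmonic for it.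

module Submission where

open import Defs
open import Data.Fin.Base
  using (Fin; zero; suc; toℕ; punchOut; remQuot; combine; finToFun; funToFin)
open import Data.Fin.Properties
  using ( _≟_; any?; sequence; <⇒notInjective; punchOut-injective
        ; remQuot-combine; finToFun-funToFin)
open import Data.Fin.Subset using (Subset; _∈_; _∉_; _⊆_; _⊂_; _⊃_; _∪_; Nonempty)
open import Data.Fin.Subset.Induction using (⊂-wellFounded; ⊃-wellFounded)
open import Data.Fin.Subset.Properties
  using (_∈?_; ∉⊥; nonempty?; ⊆-antisym; x∈p∪q⁺; x∈p∪q⁻; p⊆p∪q; q⊆p∪q)
open import Data.List.Base as List using (List; allFin; filter)
import Data.List.Extrema as Extrema
open import Data.List.Membership.Propositional using () renaming (_∈_ to _∈ₗ_)
open import Data.List.Membership.Propositional.Properties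
  using (∈-allFin; ∈-map⁺; ∈-filter⁺; ∈-filter⁻)
import Data.List.Relation.Unary.All as All
import Data.List.Relation.Unary.All.Properties as All
open import Data.Nat.Base using (ℕ; zero; suc; _^_; _⊔_; z≤n; s≤s)
  renaming (_≤_ to _≤ⁿ_; _*_ to _*ⁿ_)
open import Data.Nat.Properties using (n<1+n; m≤m⊔n; m≤n⊔m)
open import Data.Product.Base using (∃-syntax; _×_; _,_; proj₁; proj₂)
open import Data.Sum.Base using (_⊎_; inj₁; inj₂)
open import Data.Vec.Base using (Vec; _∷_; tabulate)
open import Data.Vec.Properties using (lookup∘tabulate; lookup⇒[]=; []=⇒lookup)
open import Effect.Monad using (RawMonad)
open import Function.Base using (_∘_; _$_; id; case_of_)
open import Function.Bundles using (Inverse; Equivalence)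
open import Function.Definitions using (Injective)
open import Induction.WellFounded using (Acc; acc)
open import Level using (0ℓ)
open import Relation.Binary.Bundles using (Setoid)
open import Relation.Binary.Construct.Closure.ReflexiveTransitive
  using (Star; ε; _◅_; _◅◅_; gmap)
open import Relation.Binary.PropositionalEquality.Core using (_≡_; _≢_)
import Relation.Binary.PropositionalEquality.Core as ≡
import Relation.Binary.Reasoning.PartialOrder as ≤-Reasoning
open import Relation.Nullary.Decidable
  using ( Dec; does; yes; no; _×-dec_; ¬?; toSum; dec-true
        ; decidable-stable; ¬¬-excluded-middle)
open import Relation.Nullary.Negation using (¬_; ¬¬-map; ¬¬-Monad; contradiction)
open import Relation.Unary using (Pred; Decidable; _∖_; ｛_｝)

open Sub

-- Finite sets: double negation, pigeonhole, subsets from decidable predicates.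

¬¬-∀ : ∀ {n} {P : Pred (Fin n) 0ℓ} → (∀ i → ¬ ¬ P i) → ¬ ¬ (∀ i → P i)
¬¬-∀ = sequence (RawMonad.rawApplicative ¬¬-Monad)

-- If `j` were missed, punching it out of the codomain would inject `Fin (suc n)` into `Fin n`.
injective⇒hits : ∀ {n} {f : Fin n → Fin n} → Injective _≡_ _≡_ f → ∀ j → ∃[ i ] f i ≡ j
injective⇒hits {suc n} {f} inj j with any? (λ i → f i ≟ j)
... | yes hit = hit
... | no ¬hit = contradiction
  (λ {i} {k} e → inj (punchOut-injective (miss i) (miss k) e))
  (<⇒notInjective {f = λ i → punchOut (miss i)} (n<1+n n))
  where
  miss : ∀ i → j ≢ f i
  miss i e = ¬hit (i , ≡.sym e)

module _ {n} {P : Pred (Fin n) 0ℓ} (P? : Decidable P) where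

  ⟦_⟧ : Subset n
  ⟦_⟧ = tabulate (does ∘ P?)

  ∈⟦⟧⁺ : ∀ {i} → P i → i ∈ ⟦_⟧
  ∈⟦⟧⁺ {i} p = lookup⇒[]= i ⟦_⟧ (≡.trans (lookup∘tabulate _ i) (dec-true (P? i) p))

  ∈⟦⟧⁻ : ∀ {i} → i ∈ ⟦_⟧ → P i
  ∈⟦⟧⁻ {i} i∈ with P? i | ≡.trans (≡.sym (lookup∘tabulate (does ∘ P?) i)) ([]=⇒lookup i∈)
  ... | yes p | _ = p

-- Unions of end components.

module _ (M : PMDP) where
  open PMDP M

  private
    EC  = IsEndComponent M
    MEC = IsMEC M

  _∪ₛ_ : Sub M → Sub M → Sub M
  X ∪ₛ Y = (P X ∪ P Y) ,, λ s → B X s ∪ B Y s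

  module _ {X Y : Sub M} where

    InSub-∪⁻ : ∀ {v} → InSub M (X ∪ₛ Y) v → InSub M X v ⊎ InSub M Y v
    InSub-∪⁻ (state p∈) = case x∈p∪q⁻ (P X) (P Y) p∈ of λ where
      (inj₁ p∈X) → inj₁ (state p∈X)
      (inj₂ p∈Y) → inj₂ (state p∈Y)
    InSub-∪⁻ (pair {p} a∈) = case x∈p∪q⁻ (B X p) (B Y p) a∈ of λ where
      (inj₁ a∈X) → inj₁ (pair a∈X)
      (inj₂ a∈Y) → inj₂ (pair a∈Y)

    InSub-∪⁺ : ∀ {v} → InSub M X v ⊎ InSub M Y v → InSub M (X ∪ₛ Y) v
    InSub-∪⁺ (inj₁ (state p∈)) = state (x∈p∪q⁺ (inj₁ p∈))
    InSub-∪⁺ (inj₁ (pair a∈))  = pair (x∈p∪q⁺ (inj₁ a∈))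
    InSub-∪⁺ (inj₂ (state p∈)) = state (x∈p∪q⁺ (inj₂ p∈))
    InSub-∪⁺ (inj₂ (pair a∈))  = pair (x∈p∪q⁺ (inj₂ a∈))

    -- The shared state `p` is the hub: each vertex reaches it, and is reached from it, inside its
    -- own component.
    ∪-isEndComponent : ∀ {p} → EC X → EC Y → p ∈ P X → p ∈ P Y → EC (X ∪ₛ Y)
    ∪-isEndComponent {p} (subX , connX) (subY , connY) p∈X p∈Y =
      sub , λ u∈ v∈ → to-p (InSub-∪⁻ u∈) ◅◅ from-p (InSub-∪⁻ v∈)
      where
      module X = IsSubMDP subX
      module Y = IsSubMDP subY

      sub : IsSubMDP M (X ∪ₛ Y)
      sub = record
        { B-state  = λ {p} a∈ → x∈p∪q⁺ $ case x∈p∪q⁻ (B X p) (B Y p) a∈ of λ where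
            (inj₁ a∈X) → inj₁ (X.B-state a∈X)
            (inj₂ a∈Y) → inj₂ (Y.B-state a∈Y)
        ; B-edge   = λ {p} a∈ → case x∈p∪q⁻ (B X p) (B Y p) a∈ of λ where
            (inj₁ a∈X) → X.B-edge a∈X
            (inj₂ a∈Y) → Y.B-edge a∈Y
        ; B-action = λ p∈ → case x∈p∪q⁻ (P X) (P Y) p∈ of λ where
            (inj₁ p∈X) → let a , a∈ = X.B-action p∈X in a , x∈p∪q⁺ (inj₁ a∈)
            (inj₂ p∈Y) → let a , a∈ = Y.B-action p∈Y in a , x∈p∪q⁺ (inj₂ a∈)
        ; B-closed = λ {p} a∈ t∈ → x∈p∪q⁺ $ case x∈p∪q⁻ (B X p) (B Y p) a∈ of λ where
            (inj₁ a∈X) → inj₁ (X.B-closed a∈X t∈)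
            (inj₂ a∈Y) → inj₂ (Y.B-closed a∈Y t∈)
        }

      liftX : ∀ {u v} → Star (InducedEdge M X) u v → Star (InducedEdge M (X ∪ₛ Y)) u v
      liftX = gmap id λ (u∈ , v∈ , e) → InSub-∪⁺ (inj₁ u∈) , InSub-∪⁺ (inj₁ v∈) , e

      liftY : ∀ {u v} → Star (InducedEdge M Y) u v → Star (InducedEdge M (X ∪ₛ Y)) u v
      liftY = gmap id λ (u∈ , v∈ , e) → InSub-∪⁺ (inj₂ u∈) , InSub-∪⁺ (inj₂ v∈) , e

      to-p : ∀ {v} → InSub M X v ⊎ InSub M Y v →
             Star (InducedEdge M (X ∪ₛ Y)) v (state p)
      to-p (inj₁ v∈) = liftX (connX v∈ (state p∈X))
      to-p (inj₂ v∈) = liftY (connY v∈ (state p∈Y))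

      from-p : ∀ {v} → InSub M X v ⊎ InSub M Y v →
               Star (InducedEdge M (X ∪ₛ Y)) (state p) v
      from-p (inj₁ v∈) = liftX (connX (state p∈X) v∈)
      from-p (inj₂ v∈) = liftY (connY (state p∈Y) v∈)

  -- Maximality speaks only of pairs, so inclusion of states is recovered here: each state of `X`
  -- has an action in `B X`, and a pair in `B Y` brings its state into `P Y`.
  B⊆⇒P⊆ : ∀ {X Y} → IsSubMDP M X → IsSubMDP M Y → (∀ s → B X s ⊆ B Y s) → P X ⊆ P Y
  B⊆⇒P⊆ subX subY B⊆ p∈ =
    IsSubMDP.B-state subY (B⊆ _ (proj₂ (IsSubMDP.B-action subX p∈)))

  -- The union is an end component containing all pairs of `Y`; a state of `X` outside `Y` would
  -- make it differ from `Y`, against maximality.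
  MEC-absorbs : ∀ {X Y p} → EC X → MEC Y → p ∈ P X → p ∈ P Y → P X ⊆ P Y
  MEC-absorbs {X} {Y} ecX (ecY , maximal) p∈X p∈Y {r} r∈X =
    decidable-stable (r ∈? P Y) λ r∉Y →
    maximal (X ∪ₛ Y) (∪-isEndComponent ecX ecY p∈X p∈Y)
      (λ X∪Y≈Y → r∉Y (≡.subst (r ∈_) (proj₁ X∪Y≈Y) (p⊆p∪q (P Y) r∈X)))
      (λ s → q⊆p∪q (B X s) (B Y s))

  -- Existence of maximal end components.

  pair? : (X : Sub M) → Decidable λ i → let s , a = remQuot {|S|} |A| i in a ∈ B X s
  pair? X i = let s , a = remQuot {|S|} |A| i in a ∈? B X s

  -- All pairs are flattened into a single finite subset, so that well-founded induction on strict
  -- inclusion applies.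
  pairs : Sub M → Subset (|S| *ⁿ |A|)
  pairs X = ⟦ pair? X ⟧
  
  pairs-⊂ : ∀ {X Y} → IsSubMDP M X → IsSubMDP M Y → (∀ s → B X s ⊆ B Y s) →
            ¬ _≈ₛ_ M Y X → pairs X ⊂ pairs Y
  pairs-⊂ {X} {Y} subX subY B⊆ Y≉X
    with any? (λ s → any? λ a → a ∈? B Y s ×-dec ¬? (a ∈? B X s))
  ... | yes (s , a , a∈Y , a∉X) =
        (λ i∈ → ∈⟦⟧⁺ (pair? Y) (B⊆ _ (∈⟦⟧⁻ (pair? X) i∈))) ,
        combine s a ,
        ∈⟦⟧⁺ (pair? Y) (≡.subst (λ (s , a) → a ∈ B Y s) (≡.sym (remQuot-combine s a)) a∈Y) ,
        λ i∈ → a∉X (≡.subst (λ (s , a) → a ∈ B X s) (remQuot-combine s a) (∈⟦⟧⁻ (pair? X) i∈))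
  ... | no ¬new = contradiction
        ( ⊆-antisym (B⊆⇒P⊆ subY subX ⊇B) (B⊆⇒P⊆ subX subY B⊆)
        , λ s → ⊆-antisym (⊇B s) (B⊆ s) ) Y≉X
    where
    ⊇B : ∀ s → B Y s ⊆ B X s
    ⊇B s {a} a∈Y = decidable-stable (a ∈? B X s) λ a∉X → ¬new (s , a , a∈Y , a∉X)

  -- Induction on the growth of `pairs`: if no MEC contains `p`, every strictly larger end component
  -- is already refuted, which makes `X` itself maximal.
  EC⇒¬¬MEC : ∀ {X p} → EC X → p ∈ P X → ¬ ¬ (∃[ Y ] MEC Y × p ∈ P Y)
  EC⇒¬¬MEC {X} {p} ecX p∈X ¬MEC = go X ecX p∈X (⊃-wellFounded (pairs X))
    where
    go : ∀ X → EC X → p ∈ P X → ¬ Acc _⊃_ (pairs X)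
    go X ecX p∈X (acc rec) = ¬MEC (X , (ecX , maximal) , p∈X)
      where
      maximal : ∀ Y → EC Y → ¬ _≈ₛ_ M Y X → ¬ (∀ s → B X s ⊆ B Y s)
      maximal Y ecY Y≉X B⊆ = go Y ecY (B⊆⇒P⊆ (proj₁ ecX) (proj₁ ecY) B⊆ p∈X)
        (rec (pairs-⊂ (proj₁ ecX) (proj₁ ecY) B⊆ Y≉X))

  -- End components from sets that a strategy neither leaves nor stops in.

  module _ (σ : S → A) {Q : Pred S 0ℓ}
           (enabled : ∀ {u} → Q u → Nonempty (Δ u (σ u)))
           (closed  : ∀ {u t} → Q u → t ∈ Δ u (σ u) → Q t) where

    private
      Step : S → S → Set
      Step u t = t ∈ Δ u (σ u)

      Q* : ∀ {u t} → Q u → Star Step u t → Q t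
      Q* q ε        = q
      Q* q (t∈ ◅ π) = Q* (closed q t∈) π

      ≢fail : ∀ {u} → Q u → u ≢ fail
      ≢fail q ≡.refl = Δ-fail (proj₂ (enabled q))

    module _ (reach? : ∀ u t → Dec (Star Step u t)) where

      reachSet : S → Subset |S|
      reachSet u = ⟦ reach? u ⟧

      chosen? : ∀ u t → Decidable λ a → Star Step u t × a ≡ σ t
      chosen? u t a = reach? u t ×-dec a ≟ σ t

      -- Only the actions of `σ` are kept, so closure under successors is closure under `Step`.
      reachSub : S → Sub M
      reachSub u = reachSet u ,, λ t → ⟦ chosen? u t ⟧

      reachSub-isEC : ∀ {u} → Q u → (∀ {t} → Star Step u t → Star Step t u) →
                      EC (reachSub u)
      reachSub-isEC {u} q back = record
        { B-state  = λ a∈ → ∈⟦⟧⁺ (reach? u) (proj₁ (∈B⁻ a∈))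
        ; B-edge   = λ a∈ → edge (∈B⁻ a∈)
        ; B-action = λ p∈ → _ , ∈B⁺ (∈⟦⟧⁻ (reach? u) p∈)
        ; B-closed = λ a∈ t∈ → ∈⟦⟧⁺ (reach? u) (next (∈B⁻ a∈) t∈)
        } , λ x∈ y∈ →
          -- Go from `x` to a state `v`, back to the root `u`, on to a state `w`, and from there to
          -- `y`.
          let v , π , u∼ = leave x∈; w , ρ , ∼w = arrive y∈
          in u∼ ◅◅ lift π (back π ◅◅ ρ) ◅◅ ∼w
        where
        X : Sub M
        X = reachSub u

        ∈B⁺ : ∀ {t} → Star Step u t → σ t ∈ B X t
        ∈B⁺ π = ∈⟦⟧⁺ (chosen? u _) (π , ≡.refl)

        ∈B⁻ : ∀ {t a} → a ∈ B X t → Star Step u t × a ≡ σ t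
        ∈B⁻ = ∈⟦⟧⁻ (chosen? u _)

        edge : ∀ {t a} → Star Step u t × a ≡ σ t → Edge M (state t) (pair t a)
        edge (π , ≡.refl) = let w , w∈ = enabled (Q* q π) in
          choose w∈ (≢fail (closed (Q* q π) w∈))

        next : ∀ {t a w} → Star Step u t × a ≡ σ t → w ∈ Δ t a → Star Step u w
        next (π , ≡.refl) w∈ = π ◅◅ (w∈ ◅ ε)

        enter : ∀ {t} → Star Step u t → InducedEdge M X (state t) (pair t (σ t))
        enter π = state (∈⟦⟧⁺ (reach? u) π) , pair (∈B⁺ π) , edge (π , ≡.refl)

        exit : ∀ {t w} → Star Step u t → w ∈ Δ t (σ t) →
               InducedEdge M X (pair t (σ t)) (state w)
        exit π w∈ = pair (∈B⁺ π) , state (∈⟦⟧⁺ (reach? u) (next (π , ≡.refl) w∈)) , move w∈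

        lift : ∀ {t w} → Star Step u t → Star Step t w →
               Star (InducedEdge M X) (state t) (state w)
        lift π ε        = ε
        lift π (w∈ ◅ ρ) = enter π ◅ exit π w∈ ◅ lift (next (π , ≡.refl) w∈) ρ

        leave : ∀ {x} → InSub M X x →
                ∃[ t ] Star Step u t × Star (InducedEdge M X) x (state t)
        leave (state t∈) = _ , ∈⟦⟧⁻ (reach? u) t∈ , ε
        leave (pair a∈) with π , ≡.refl ← ∈B⁻ a∈ =
          let w , w∈ = enabled (Q* q π) in w , next (π , ≡.refl) w∈ , exit π w∈ ◅ ε

        arrive : ∀ {y} → InSub M X y →
                 ∃[ t ] Star Step u t × Star (InducedEdge M X) (state t) y
        arrive (state t∈) = _ , ∈⟦⟧⁻ (reach? u) t∈ , ε
        arrive (pair a∈) with π , ≡.refl ← ∈B⁻ a∈ = _ , π , enter π ◅ ε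

      -- An inclusion-minimal set reachSet u is strongly connected.
      closed⇒EC : ∀ {u} → Q u → ∃[ X ] EC X × ∃[ p ] p ∈ P X
      closed⇒EC {u} q = go u q (⊂-wellFounded (reachSet u))
        where
        go : ∀ u → Q u → Acc _⊂_ (reachSet u) → ∃[ X ] EC X × ∃[ p ] p ∈ P X
        go u q (acc rec) with any? (λ t → reach? u t ×-dec ¬? (reach? t u))
        ... | yes (t , π , ¬ρ) = go t (Q* q π) $ rec
              ( (λ w∈ → ∈⟦⟧⁺ (reach? u) (π ◅◅ ∈⟦⟧⁻ (reach? t) w∈))
              , u , ∈⟦⟧⁺ (reach? u) ε , λ u∈ → ¬ρ (∈⟦⟧⁻ (reach? t) u∈) )
        ... | no ¬escape =
              reachSub u ,
              reachSub-isEC q (λ {t} π → decidable-stable (reach? t u) λ ¬ρ → ¬escape (t , π , ¬ρ)) ,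
              u , ∈⟦⟧⁺ (reach? u) ε

    -- There are finitely many pairs of states, so excluded middle for reachability holds for all of
    -- them at once under a double negation.
    closed⇒¬¬EC : ∀ {u} → Q u → ¬ ¬ (∃[ X ] EC X × ∃[ p ] p ∈ P X)
    closed⇒¬¬EC q = ¬¬-map (λ reach? → closed⇒EC reach? q)
      (¬¬-∀ λ u → ¬¬-∀ λ t → ¬¬-excluded-middle)

  -- Consequences of being isomorphic to the MEC-quotient.

  module _ (iso : structure M ≅ MEC-quotient M) where
    open _≅_ iso
    private
      module I = Inverse onStates

      _~_ : S → S → Set
      _~_ = Setoid._≈_ (classes M)

    to-injective : Injective _≡_ _≡_ I.to
    to-injective {x} {y} fx≡fy = ≡.trans (≡.sym (I.strictlyInverseʳ x))
      (≡.trans (≡.cong I.from fx≡fy) (I.strictlyInverseʳ y))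

    -- The carrier of the quotient is `S` itself, so `I.to` is an injection of a finite set into
    -- itself and hits every representative exactly. Equivalent representatives have equal
    -- preimages, hence are equal.
    ~⇒≡ : ∀ {s t} → s ~ t → s ≡ t
    ~⇒≡ {s} {t} s~t with injective⇒hits to-injective s | injective⇒hits to-injective t
    ... | i , ≡.refl | j , ≡.refl = ≡.cong I.to
      (≡.trans (≡.sym (I.strictlyInverseʳ i)) (≡.trans (I.from-cong s~t) (I.strictlyInverseʳ j)))

    -- Transitions of the quotient join different classes, whereas a self-loop would be mapped to
    -- one from a class to itself.
    Δ-irreflexive : ∀ {s a} → s ∉ Δ s a
    Δ-irreflexive {s} {a} s∈ =
      let s′ , t′ , s′~ , t′~ , _ , s′≁t′ = Equivalence.to (Δ-preserved s a s) s∈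
      in s′≁t′ (trans~ s′~ (sym~ t′~))
      where open Setoid (classes M) using () renaming (sym to sym~; trans to trans~)

    -- A successor inside a MEC has the same class as its source, so it equals the source and yields
    -- a self-loop.
    no-EC : ∀ {X p} → EC X → ¬ p ∈ P X
    no-EC ecX p∈X = EC⇒¬¬MEC ecX p∈X no-MEC
      where
      -- Any MEC containing `p` absorbs `X` and so contains `t`; the singleton case is excluded by
      -- `X`.
      ⊆class : ∀ {X p t} → MEC X → p ∈ P X → t ∈ P X → ∀ {r} → [_] M p r → [_] M t r
      ⊆class mecX p∈X t∈X (inj₁ (Y , mecY , p∈Y , r∈Y)) =
        inj₁ (Y , mecY , MEC-absorbs (proj₁ mecX) mecY p∈X p∈Y t∈X , r∈Y)
      ⊆class mecX p∈X t∈X (inj₂ (¬MEC , _)) = contradiction (_ , mecX , p∈X) ¬MEC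

      no-MEC : ¬ (∃[ Y ] MEC Y × _ ∈ P Y)
      no-MEC (Y , mecY@((subY , _) , _) , p∈Y) with IsSubMDP.B-action subY p∈Y
      ... | a , a∈ with IsSubMDP.B-edge subY a∈
      ...   | choose t∈ _ =
              let t∈Y = IsSubMDP.B-closed subY a∈ t∈
                  p≡t = ~⇒≡ (⊆class mecY p∈Y t∈Y , ⊆class mecY t∈Y p∈Y)
              in Δ-irreflexive (≡.subst (_∈ Δ _ a) (≡.sym p≡t) t∈)

-- Inequalities in ordered fields and finite sums.

module OrderedField (ℝ : RealField) where
  open RealField ℝ hiding (zero)
  open import Algebra.Properties.Ring ring using (-1*x≈-x; -‿involutive)
  open ≤-Reasoning poset

  +-mono-≤ : ∀ {x y u v} → x ≤ y → u ≤ v → x + u ≤ y + v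
  +-mono-≤ {x} {y} {u} {v} x≤y u≤v = begin
    x + u ≤⟨ +-monoˡ-≤ u x≤y ⟩
    y + u ≈⟨ +-comm y u ⟩
    u + y ≤⟨ +-monoˡ-≤ y u≤v ⟩
    v + y ≈⟨ +-comm v y ⟩
    y + v ∎

  x+y-y≈x : ∀ x y → x + y - y ≈ x
  x+y-y≈x x y = begin-equality
    x + y - y    ≈⟨ +-assoc x y (- y) ⟩
    x + (y - y)  ≈⟨ +-congˡ (-‿inverseʳ y) ⟩
    x + 0#       ≈⟨ +-identityʳ x ⟩
    x            ∎

  x-y+y≈x : ∀ x y → x - y + y ≈ x
  x-y+y≈x x y = begin-equality
    x - y + y      ≈⟨ +-assoc x (- y) y ⟩
    x + (- y + y)  ≈⟨ +-congˡ (-‿inverseˡ y) ⟩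
    x + 0#         ≈⟨ +-identityʳ x ⟩
    x              ∎

  x+y≤z⇒x≤z-y : ∀ {x y z} → x + y ≤ z → x ≤ z - y
  x+y≤z⇒x≤z-y {x} {y} {z} x+y≤z = begin
    x          ≈⟨ x+y-y≈x x y ⟨
    x + y - y  ≤⟨ +-monoˡ-≤ (- y) x+y≤z ⟩
    z - y      ∎

  x≤z-y⇒x+y≤z : ∀ {x y z} → x ≤ z - y → x + y ≤ z
  x≤z-y⇒x+y≤z {x} {y} {z} x≤z-y = begin
    x + y      ≤⟨ +-monoˡ-≤ y x≤z-y ⟩
    z - y + y  ≈⟨ x-y+y≈x z y ⟩
    z          ∎

  +-cancelʳ-≤ : ∀ {x y} z → x + z ≤ y + z → x ≤ y
  +-cancelʳ-≤ {x} {y} z x+z≤y+z = begin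
    x          ≤⟨ x+y≤z⇒x≤z-y x+z≤y+z ⟩
    y + z - z  ≈⟨ x+y-y≈x y z ⟩
    y          ∎

  *-monoˡ-≤ : ∀ {c x y} → 0# ≤ c → x ≤ y → c * x ≤ c * y
  *-monoˡ-≤ {c} {x} {y} 0≤c x≤y = begin
    c * x                  ≈⟨ +-identityˡ (c * x) ⟨
    0# + c * x             ≤⟨ +-monoˡ-≤ (c * x) (*-nonNeg 0≤c (x+y≤z⇒x≤z-y 0+x≤y)) ⟩
    c * (y - x) + c * x    ≈⟨ distribˡ c (y - x) x ⟨
    c * (y - x + x)        ≈⟨ *-congˡ (x-y+y≈x y x) ⟩
    c * y                  ∎
    where
    0+x≤y : 0# + x ≤ y
    0+x≤y = ≤-trans (≤-reflexive (+-identityˡ x)) x≤y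

  0≤1 : 0# ≤ 1#
  0≤1 with ≤-total 0# 1#
  ... | inj₁ 0≤1 = 0≤1
  ... | inj₂ 1≤0 = begin
    0#              ≤⟨ *-nonNeg 0≤-1 0≤-1 ⟩
    - 1# * - 1#     ≈⟨ -1*x≈-x (- 1#) ⟩
    - - 1#          ≈⟨ -‿involutive 1# ⟩
    1#              ∎
    where
    0≤-1 : 0# ≤ - 1#
    0≤-1 = begin
      0#       ≤⟨ x+y≤z⇒x≤z-y (≤-trans (≤-reflexive (+-identityˡ 1#)) 1≤0) ⟩
      0# - 1#  ≈⟨ +-identityˡ (- 1#) ⟩
      - 1#     ∎

  1≰0 : ¬ 1# ≤ 0#
  1≰0 1≤0 = 0≉1 (≤-antisym 0≤1 1≤0)

  inverse-nonNeg : ∀ {c d} → 0# ≤ c → c * d ≈ 1# → 0# ≤ d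
  inverse-nonNeg {c} {d} 0≤c cd≈1 with ≤-total 0# d
  ... | inj₁ 0≤d = 0≤d
  ... | inj₂ d≤0 = contradiction 1≤0 1≰0
    where
    1≤0 : 1# ≤ 0#
    1≤0 = begin
      1#      ≈⟨ cd≈1 ⟨
      c * d   ≤⟨ *-monoˡ-≤ 0≤c d≤0 ⟩
      c * 0#  ≈⟨ zeroʳ c ⟩
      0#      ∎

  inverse-cancelˡ : ∀ {c d} → c * d ≈ 1# → ∀ x → c * (d * x) ≈ x
  inverse-cancelˡ {c} {d} cd≈1 x = begin-equality
    c * (d * x)  ≈⟨ *-assoc c d x ⟨
    c * d * x    ≈⟨ *-congʳ cd≈1 ⟩
    1# * x       ≈⟨ *-identityˡ x ⟩
    x            ∎

  *-cancelˡ-≤ : ∀ {c x y} → 0# < c → c * x ≤ c * y → x ≤ y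
  *-cancelˡ-≤ {c} {x} {y} (0≤c , 0≉c) cx≤cy with inverse (0≉c ∘ sym)
  ... | d , cd≈1 = begin
    x            ≈⟨ inverse-cancelˡ dc≈1 x ⟨
    d * (c * x)  ≤⟨ *-monoˡ-≤ (inverse-nonNeg 0≤c cd≈1) cx≤cy ⟩
    d * (c * y)  ≈⟨ inverse-cancelˡ dc≈1 y ⟩
    y            ∎
    where
    dc≈1 : d * c ≈ 1#
    dc≈1 = trans (*-comm d c) cd≈1

  sum-mono-≤ : ∀ {n} {f g : Fin n → Carrier} → (∀ i → f i ≤ g i) → sum f ≤ sum g
  sum-mono-≤ {zero}  f≤g = ≤-refl
  sum-mono-≤ {suc n} f≤g = +-mono-≤ (f≤g zero) (sum-mono-≤ (f≤g ∘ suc))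

  sum-≈0 : ∀ {n} {f : Fin n → Carrier} → (∀ i → f i ≈ 0#) → sum f ≈ 0#
  sum-≈0 {n} f≈0 = trans (sum-cong-≋ f≈0) (sum-replicate-zero n)

  sum-nonNeg : ∀ {n} {f : Fin n → Carrier} → (∀ i → 0# ≤ f i) → 0# ≤ sum f
  sum-nonNeg {n} {f} 0≤f = begin
    0#            ≈⟨ sum-≈0 {n} (λ _ → refl) ⟨
    sum {n} (λ _ → 0#)  ≤⟨ sum-mono-≤ 0≤f ⟩
    sum f         ∎

  -- Cancelling all other terms, each bounded the right way, isolates a single index.
  sum-≤-equality : ∀ {n} {f g : Fin n → Carrier} →
                   (∀ i → f i ≤ g i) → sum g ≤ sum f → ∀ i → g i ≤ f i
  sum-≤-equality {suc n} {f} {g} f≤g ∑g≤∑f zero = +-cancelʳ-≤ (sum (g ∘ suc)) (begin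
    g zero + sum (g ∘ suc)  ≤⟨ ∑g≤∑f ⟩
    f zero + sum (f ∘ suc)  ≤⟨ +-mono-≤ ≤-refl (sum-mono-≤ (f≤g ∘ suc)) ⟩
    f zero + sum (g ∘ suc)  ∎)
  sum-≤-equality {suc n} {f} {g} f≤g ∑g≤∑f (suc i) =
    sum-≤-equality (f≤g ∘ suc) (+-cancelʳ-≤ (g zero) (begin
      sum (g ∘ suc) + g zero  ≈⟨ +-comm _ _ ⟩
      g zero + sum (g ∘ suc)  ≤⟨ ∑g≤∑f ⟩
      f zero + sum (f ∘ suc)  ≤⟨ +-monoˡ-≤ _ (f≤g zero) ⟩
      g zero + sum (f ∘ suc)  ≈⟨ +-comm _ _ ⟩
      sum (f ∘ suc) + g zero  ∎)) i

  -- Since the weights sum to 1, `m` is the average of the constant `m`; the two averages then agree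
  -- term by term, and a positive weight can be cancelled.
  average-attains-max : ∀ {n} {c g : Fin n → Carrier} {m} →
    (∀ i → 0# ≤ c i) → ∑[ i < n ] c i ≈ 1# → (∀ i → g i ≤ m) →
    m ≤ ∑[ i < n ] (c i * g i) → ∀ {i} → 0# < c i → m ≤ g i
  average-attains-max {n} {c} {g} {m} 0≤c ∑c≈1 g≤m m≤∑ {i} 0<ci = *-cancelˡ-≤ 0<ci
    (sum-≤-equality (λ j → *-monoˡ-≤ (0≤c j) (g≤m j)) (begin
      (∑[ j < n ] (c j * m))    ≈⟨ *-distribʳ-sum m c ⟨
      (∑[ j < n ] c j) * m      ≈⟨ *-congʳ ∑c≈1 ⟩
      1# * m                    ≈⟨ *-identityˡ m ⟩
      m                         ≤⟨ m≤∑ ⟩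
      (∑[ j < n ] (c j * g j))  ∎) i)

  -- Suprema of monotone sequences.

  IsSup : (ℕ → Carrier) → Carrier → Set
  IsSup f l = (∀ k → f k ≤ l) × (∀ {b} → (∀ k → f k ≤ b) → l ≤ b)

  Monotone : (ℕ → Carrier) → Set
  Monotone f = ∀ {j k} → j ≤ⁿ k → f j ≤ f k

  -- For invertible `c`, the quotient of `b` by `c` bounds every `f k`. For `c` zero both products
  -- vanish, and index 0 serves as well as any other.
  scale-sup-≤ : ∀ {c f l b} → 0# ≤ c → IsSup f l → (∀ k → c * f k ≤ b) → c * l ≤ b
  scale-sup-≤ {c} {f} {l} {b} 0≤c (_ , least) cf≤b with c ≈? 0#
  ... | yes c≈0 = begin
    c * l    ≈⟨ *-congʳ c≈0 ⟩
    0# * l   ≈⟨ trans (zeroˡ l) (sym (zeroˡ (f 0))) ⟩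
    0# * f 0 ≈⟨ *-congʳ c≈0 ⟨
    c * f 0  ≤⟨ cf≤b 0 ⟩
    b        ∎
  ... | no c≉0 with inverse c≉0
  ...   | d , cd≈1 = begin
    c * l        ≤⟨ *-monoˡ-≤ 0≤c (least λ k → *-cancelˡ-≤ (0≤c , c≉0 ∘ sym) (begin
      c * f k        ≤⟨ cf≤b k ⟩
      b              ≈⟨ inverse-cancelˡ cd≈1 b ⟨
      c * (d * b)    ∎)) ⟩
    c * (d * b)  ≈⟨ inverse-cancelˡ cd≈1 b ⟩
    b            ∎

  -- Monotone convergence for finite sums. Head and tail pass to their suprema one after the other,
  -- so their indices are first made independent by moving both to `j ⊔ k`.
  ∑-sup-≤ : ∀ {n} {c : Fin n → Carrier} {f : ℕ → Fin n → Carrier} {l : Fin n → Carrier} {b} →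
    (∀ i → 0# ≤ c i) → (∀ i → Monotone (λ k → f k i)) → (∀ i → IsSup (λ k → f k i) (l i)) →
    (∀ k → ∑[ i < n ] (c i * f k i) ≤ b) → ∑[ i < n ] (c i * l i) ≤ b
  ∑-sup-≤ {zero}  _ _ _ ∑≤b = ∑≤b 0
  ∑-sup-≤ {suc n} {c} {f} {l} {b} 0≤c mono sup-l ∑≤b = begin
    c zero * l zero + (∑[ i < n ] (c (suc i) * l (suc i)))  ≈⟨ +-comm _ _ ⟩
    (∑[ i < n ] (c (suc i) * l (suc i))) + c zero * l zero
      ≤⟨ x≤z-y⇒x+y≤z (∑-sup-≤ (0≤c ∘ suc) (λ i → mono (suc i)) (sup-l ∘ suc) tail≤) ⟩
    b ∎
    where
    tail : ℕ → Carrier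
    tail k = ∑[ i < n ] (c (suc i) * f k (suc i))

    head≤ : ∀ k j → c zero * f j zero ≤ b - tail k
    head≤ k j = x+y≤z⇒x≤z-y (begin
      c zero * f j zero + tail k
        ≤⟨ +-mono-≤ (*-monoˡ-≤ (0≤c zero) (mono zero (m≤m⊔n j k)))
                    (sum-mono-≤ λ i → *-monoˡ-≤ (0≤c (suc i)) (mono (suc i) (m≤n⊔m j k))) ⟩
      c zero * f (j ⊔ k) zero + tail (j ⊔ k)  ≤⟨ ∑≤b (j ⊔ k) ⟩
      b ∎)

    tail≤ : ∀ k → tail k ≤ b - c zero * l zero
    tail≤ k = x+y≤z⇒x≤z-y (begin
      tail k + c zero * l zero  ≈⟨ +-comm _ _ ⟩
      c zero * l zero + tail k  ≤⟨ x≤z-y⇒x+y≤z (scale-sup-≤ (0≤c zero) (sup-l zero) (head≤ k)) ⟩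
      b                         ∎)

-- Reachability probabilities as least solutions and the maximum principle.

module Reachability (ℝ : RealField) {n} (C : MarkovChain ℝ n) (goal : Fin n) where
  open RealField ℝ hiding (zero)
  open OrderedField ℝ
  open MarkovChain C
  open ≤-Reasoning poset

  private
    hit = hitBefore ℝ C goal
    h   = ℙ[◇] ℝ C goal

  ∑paths-*ˡ : ∀ k c (f : Vec (Fin n) k → Carrier) →
              ∑paths ℝ k (λ π → c * f π) ≈ c * ∑paths ℝ k f
  ∑paths-*ˡ zero    c f = refl
  ∑paths-*ˡ (suc k) c f = trans
    (sum-cong-≋ (λ t → ∑paths-*ˡ k c (f ∘ (t ∷_))))
    (sym (*-distribˡ-sum c (λ t → ∑paths ℝ k (f ∘ (t ∷_)))))

  ∑paths-0 : ∀ k → ∑paths ℝ {n} k (λ _ → 0#) ≈ 0#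
  ∑paths-0 zero    = refl
  ∑paths-0 (suc k) = sum-≈0 {n} (λ _ → ∑paths-0 k)

  -- `hit k` counts hitting times strictly below `k`, so time 0 enters only from `k = 1` on.
  hitBefore-goal : ∀ k → hit (suc k) goal ≈ 1#
  hitBefore-goal k with goal ≟ goal
  ... | yes _ = trans (+-congˡ (sum-≈0 {k} (λ j → ∑paths-0 (suc (toℕ j))))) (+-identityʳ 1#)
  ... | no ≢  = contradiction ≡.refl ≢

  -- First-step decomposition: off the goal the time-0 term vanishes and every later term factors
  -- through the first successor.
  hitBefore-step : ∀ k {s} → s ≢ goal → hit (suc k) s ≈ ∑[ t < n ] (μ s t * hit k t)
  hitBefore-step k {s} s≢ with s ≟ goal
  ... | yes s≡ = contradiction s≡ s≢
  ... | no _ = begin-equality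
    0# + (∑[ j < k ] ∑[ t < n ] ∑paths ℝ (toℕ j) (λ π → μ s t * hitWeight ℝ C goal t π))
      ≈⟨ +-identityˡ _ ⟩
    (∑[ j < k ] ∑[ t < n ] ∑paths ℝ (toℕ j) (λ π → μ s t * hitWeight ℝ C goal t π))
      ≈⟨ sum-cong-≋ {k} (λ j → sum-cong-≋ {n} λ t →
           ∑paths-*ˡ (toℕ j) (μ s t) (hitWeight ℝ C goal t)) ⟩
    (∑[ j < k ] ∑[ t < n ] (μ s t * hitAt ℝ C goal (toℕ j) t))
      ≈⟨ ∑-comm {k} {n} (λ j t → μ s t * hitAt ℝ C goal (toℕ j) t) ⟩
    (∑[ t < n ] ∑[ j < k ] (μ s t * hitAt ℝ C goal (toℕ j) t))
      ≈⟨ sum-cong-≋ {n} (λ t → *-distribˡ-sum {k} (μ s t) (λ j → hitAt ℝ C goal (toℕ j) t)) ⟨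
    (∑[ t < n ] (μ s t * hit k t)) ∎

  hitBefore-nonNeg : ∀ k s → 0# ≤ hit k s
  hitBefore-nonNeg zero    s = ≤-refl
  hitBefore-nonNeg (suc k) s with toSum (s ≟ goal)
  ... | inj₁ ≡.refl = ≤-trans 0≤1 (≤-reflexive (sym (hitBefore-goal k)))
  ... | inj₂ s≢     = ≤-trans
    (sum-nonNeg λ t → *-nonNeg (μ-nonNeg s t) (hitBefore-nonNeg k t))
    (≤-reflexive (sym (hitBefore-step k s≢)))

  hitBefore-mono : ∀ s → Monotone (λ k → hit k s)
  hitBefore-mono s {k = k} z≤n = hitBefore-nonNeg k s
  hitBefore-mono s (s≤s {j} {k} j≤k) with toSum (s ≟ goal)
  ... | inj₁ ≡.refl = ≤-reflexive (trans (hitBefore-goal j) (sym (hitBefore-goal k)))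
  ... | inj₂ s≢     = begin
    hit (suc j) s                   ≈⟨ hitBefore-step j s≢ ⟩
    (∑[ t < n ] (μ s t * hit j t))  ≤⟨ sum-mono-≤ (λ t → *-monoˡ-≤ (μ-nonNeg s t) (hitBefore-mono t j≤k)) ⟩
    (∑[ t < n ] (μ s t * hit k t))  ≈⟨ hitBefore-step k s≢ ⟨
    hit (suc k) s                   ∎

  ℙ-isSup : ∀ s → IsSup (λ k → hit k s) (h s)
  ℙ-isSup s = (λ k → upper (k , refl)) , λ hit≤b → least λ (k , x≈) → ≤-trans (≤-reflexive x≈) (hit≤b k)
    where
    -- The instance of completeness used in the definition of `ℙ[◇]`, so its first component is
    -- `h s` by computation.
    lub = complete (HitBefore ℝ C goal s) (_ , 0 , refl)
                   (1# , λ (k , x≈) → ≤-trans (≤-reflexive x≈) (hitBefore≤1 ℝ C goal k s))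
    upper = proj₁ (proj₂ lub)
    least = proj₂ (proj₂ lub)

  ℙ-nonNeg : ∀ s → 0# ≤ h s
  ℙ-nonNeg s = proj₁ (ℙ-isSup s) 0

  ℙ≤1 : ∀ s → h s ≤ 1#
  ℙ≤1 s = proj₂ (ℙ-isSup s) (λ k → hitBefore≤1 ℝ C goal k s)

  1≤ℙ-goal : 1# ≤ h goal
  1≤ℙ-goal = ≤-trans (≤-reflexive (sym (hitBefore-goal 0))) (proj₁ (ℙ-isSup goal) 1)

  ℙ≤∑ : ∀ {s} → s ≢ goal → h s ≤ ∑[ t < n ] (μ s t * h t)
  ℙ≤∑ {s} s≢ = proj₂ (ℙ-isSup s) λ where
    zero    → sum-nonNeg λ t → *-nonNeg (μ-nonNeg s t) (ℙ-nonNeg t)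
    (suc k) → begin
      hit (suc k) s                   ≈⟨ hitBefore-step k s≢ ⟩
      (∑[ t < n ] (μ s t * hit k t))  ≤⟨ sum-mono-≤ (λ t → *-monoˡ-≤ (μ-nonNeg s t) (proj₁ (ℙ-isSup t) k)) ⟩
      (∑[ t < n ] (μ s t * h t))      ∎

  -- With `ℙ≤∑` this makes `h` harmonic off the goal; here the supremum is exchanged with the finite
  -- sum.
  ∑≤ℙ : ∀ {s} → s ≢ goal → ∑[ t < n ] (μ s t * h t) ≤ h s
  ∑≤ℙ {s} s≢ = ∑-sup-≤ (μ-nonNeg s) hitBefore-mono ℙ-isSup λ k →
    ≤-trans (≤-reflexive (sym (hitBefore-step k s≢))) (proj₁ (ℙ-isSup s) (suc k))

  -- Induction on the number of steps keeps every partial probability below a supersolution `g`.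
  ℙ-least : {g : Fin n → Carrier} → (∀ s → 0# ≤ g s) → 1# ≤ g goal →
            (∀ {s} → s ≢ goal → ∑[ t < n ] (μ s t * g t) ≤ g s) → ∀ s → h s ≤ g s
  ℙ-least {g} 0≤g 1≤g super s = proj₂ (ℙ-isSup s) λ k → hit≤g k s
    where
    hit≤g : ∀ k s → hit k s ≤ g s
    hit≤g zero    s = 0≤g s
    hit≤g (suc k) s with toSum (s ≟ goal)
    ... | inj₁ ≡.refl = ≤-trans (≤-reflexive (hitBefore-goal k)) 1≤g
    ... | inj₂ s≢     = begin
      hit (suc k) s                   ≈⟨ hitBefore-step k s≢ ⟩
      (∑[ t < n ] (μ s t * hit k t))  ≤⟨ sum-mono-≤ (λ t → *-monoˡ-≤ (μ-nonNeg s t) (hit≤g k t)) ⟩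
      (∑[ t < n ] (μ s t * g t))      ≤⟨ super s≢ ⟩
      g s                             ∎

  -- Maximum principle: if g − ℙ[◇ goal] is positive somewhere, its maximisers
  -- form a set in which the chain stays forever while avoiding goal.
  subharmonic≤ℙ :
    ((Q : Pred (Fin n) 0ℓ) →
     (∀ {s} → Q s → ∑[ t < n ] μ s t ≈ 1#) →
     (∀ {s t} → Q s → 0# < μ s t → Q t) →
     (∀ {s} → Q s → s ≢ goal) → ∀ s → ¬ Q s) →
    {g : Fin n → Carrier} → g goal ≤ 1# →
    (∀ {s} → s ≢ goal → g s ≤ ∑[ t < n ] (μ s t * g t)) → ∀ s → g s ≤ h s
  subharmonic≤ℙ no-trap {g} g≤1 sub s with g s ≤? h s
  ... | yes g≤h = g≤h
  ... | no  g≰h = contradiction ≤-refl (no-trap Q Q-row Q-closed Q≢goal top)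
    where
    open Extrema totalOrder using (argmax; f[xs]≤f[argmax])

    W : Fin n → Carrier
    W t = g t - h t

    top : Fin n
    top = argmax W s (allFin n)

    W≤top : ∀ t → W t ≤ W top
    W≤top t = All.lookup (f[xs]≤f[argmax] s (allFin n)) (∈-allFin t)

    Q : Pred (Fin n) 0ℓ
    Q t = W top ≤ W t

    -- The excess of `g` over `h` at a maximiser is at least the one at `s`, which is positive.
    Q⇒g≰h : ∀ {t} → Q t → ¬ g t ≤ h t
    Q⇒g≰h {t} q g≤h = g≰h (begin
      g s          ≈⟨ x-y+y≈x (g s) (h s) ⟨
      W s + h s    ≤⟨ +-monoˡ-≤ (h s) (W≤top s) ⟩
      W top + h s  ≤⟨ +-monoˡ-≤ (h s) (≤-trans q W≤0) ⟩
      0# + h s     ≈⟨ +-identityˡ (h s) ⟩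
      h s          ∎)
      where
      W≤0 : W t ≤ 0#
      W≤0 = ≤-trans (+-monoˡ-≤ (- h t) g≤h) (≤-reflexive (-‿inverseʳ (h t)))

    Q≢goal : ∀ {t} → Q t → t ≢ goal
    Q≢goal q ≡.refl = Q⇒g≰h q (≤-trans g≤1 1≤ℙ-goal)

    -- In a stopping state the row is zero, and subharmonicity would give `g t ≤ 0 ≤ h t`.
    Q-row : ∀ {t} → Q t → ∑[ u < n ] μ t u ≈ 1#
    Q-row {t} q with μ-row t
    ... | inj₁ ∑≈1 = ∑≈1
    ... | inj₂ μ≈0 = contradiction
      (begin
        g t                         ≤⟨ sub (Q≢goal q) ⟩
        (∑[ u < n ] (μ t u * g u))  ≈⟨ sum-≈0 (λ u → trans (*-congʳ (μ≈0 u)) (zeroˡ (g u))) ⟩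
        0#                          ≤⟨ ℙ-nonNeg t ⟩
        h t                         ∎)
      (Q⇒g≰h q)

    -- Subtracting `h`, which is superharmonic off the goal, preserves subharmonicity.
    W-sub : ∀ {t} → t ≢ goal → W t ≤ ∑[ u < n ] (μ t u * W u)
    W-sub {t} t≢ = +-cancelʳ-≤ (∑[ u < n ] (μ t u * h u)) (begin
      W t + (∑[ u < n ] (μ t u * h u))
        ≤⟨ +-mono-≤ ≤-refl (∑≤ℙ t≢) ⟩
      W t + h t
        ≈⟨ x-y+y≈x (g t) (h t) ⟩
      g t
        ≤⟨ sub t≢ ⟩
      (∑[ u < n ] (μ t u * g u))
        ≈⟨ sum-cong-≋ (λ u → *-congˡ (x-y+y≈x (g u) (h u))) ⟨
      (∑[ u < n ] (μ t u * (W u + h u)))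
        ≈⟨ sum-cong-≋ (λ u → distribˡ (μ t u) (W u) (h u)) ⟩
      (∑[ u < n ] (μ t u * W u + μ t u * h u))
        ≈⟨ ∑-distrib-+ (λ u → μ t u * W u) (λ u → μ t u * h u) ⟩
      (∑[ u < n ] (μ t u * W u)) + (∑[ u < n ] (μ t u * h u)) ∎)

    Q-closed : ∀ {t u} → Q t → 0# < μ t u → Q u
    Q-closed {t} q = average-attains-max (μ-nonNeg t) (Q-row q) W≤top
      (≤-trans q (W-sub (Q≢goal q)))

-- Optimal values and greedy strategies.

module _ (ℝ : RealField) (M : PMDP) (val : Valuation ℝ M) where
  open RealField ℝ hiding (zero)
  open OrderedField ℝ
  open PMDP M
  open Valuation val
  open Extrema totalOrder
    using (argmax; argmax-all; f[xs]≤f[argmax]; ⊥≤max; xs≤max; max≤v⁺)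

  backup : (S → Carrier) → S → A → Carrier
  backup g u c = ∑[ t < |S| ] (prob u c t * g t)

  private
    V : S → Carrier
    V = maxℙ[◇fin] ℝ M val

    value : (S → A) → S → Carrier
    value σ = ℙ[◇] ℝ (induced ℝ M val σ) fin

    values : S → List Carrier
    values u = List.map (λ σ → value σ u) (strategies ℝ M)

    module R σ = Reachability ℝ (induced ℝ M val σ) fin

  prob-nonNeg : ∀ u c t → 0# ≤ prob u c t
  prob-nonNeg u c = MarkovChain.μ-nonNeg (induced ℝ M val (λ _ → c)) u

  backup-nonNeg : ∀ {g} → (∀ t → 0# ≤ g t) → ∀ u c → 0# ≤ backup g u c
  backup-nonNeg 0≤g u c = sum-nonNeg λ t → *-nonNeg (prob-nonNeg u c t) (0≤g t)

  backup-disabled : ∀ {g u c} → ¬ Nonempty (Δ u c) → backup g u c ≈ 0#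
  backup-disabled {g} ¬ne = sum-≈0 λ t → trans (*-congʳ (outside λ t∈ → ¬ne (t , t∈))) (zeroˡ (g t))

  row≈1⇒enabled : ∀ {u c} → ∑[ t < |S| ] prob u c t ≈ 1# → Nonempty (Δ u c)
  row≈1⇒enabled {u} {c} ∑≈1 = decidable-stable (nonempty? (Δ u c)) λ ¬ne →
    0≉1 (trans (sym (sum-≈0 λ t → outside λ t∈ → ¬ne (t , t∈))) ∑≈1)

  maxℙ-nonNeg : ∀ u → 0# ≤ V u
  maxℙ-nonNeg u = ⊥≤max 0# (values u)

  value≤maxℙ : ∀ {σ} → σ ∈ₗ strategies ℝ M → ∀ u → value σ u ≤ V u
  value≤maxℙ σ∈ u = All.lookup (xs≤max 0# (values u)) (∈-map⁺ (λ σ → value σ u) σ∈)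

  maxℙ≤ : ∀ {u b} → 0# ≤ b → (∀ {σ} → σ ∈ₗ strategies ℝ M → value σ u ≤ b) → V u ≤ b
  maxℙ≤ {u} 0≤b value≤b = max≤v⁺ 0≤b (All.map⁺ (All.tabulate value≤b))

  maxℙ≤1 : ∀ u → V u ≤ 1#
  maxℙ≤1 u = maxℙ≤ 0≤1 λ {σ} _ → R.ℙ≤1 σ u

  -- One half of the Bellman equation: unfold one step under each strategy and bound the successors
  -- by their optimal values.
  maxℙ≤backup : ∀ {u b} → u ≢ fin → 0# ≤ b → (∀ c → backup V u c ≤ b) → V u ≤ b
  maxℙ≤backup {u} u≢ 0≤b backup≤b = maxℙ≤ 0≤b λ {σ} σ∈ →
    ≤-trans (R.ℙ≤∑ σ u≢)
      (≤-trans (sum-mono-≤ λ t → *-monoˡ-≤ (prob-nonNeg u (σ u) t) (value≤maxℙ σ∈ t))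
               (backup≤b (σ u)))

  finToFun∈strategies : ∀ i → IsStrategy ℝ M (finToFun i) → finToFun i ∈ₗ strategies ℝ M
  finToFun∈strategies i = ∈-filter⁺ (isStrategy? ℝ M) (∈-map⁺ finToFun (∈-allFin i))

  -- Disabled actions have backup 0, so maximising over the enabled ones is enough.
  greedyAction : ∀ {g} → (∀ t → 0# ≤ g t) → A → ∀ u →
    ∃[ c ] ((∃[ d ] Nonempty (Δ u d)) → Nonempty (Δ u c)) × (∀ d → backup g u d ≤ backup g u c)
  greedyAction {g} 0≤g a u with any? (λ c → nonempty? (Δ u c))
  ... | no  none = a , (λ some → contradiction some none) , λ d →
          ≤-trans (≤-reflexive (backup-disabled λ ne → none (d , ne))) (backup-nonNeg 0≤g u a)
  ... | yes (c₀ , ne₀) = best , (λ _ → best-enabled) , best-maximal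
    where
    enabled? : Decidable λ c → Nonempty (Δ u c)
    enabled? c = nonempty? (Δ u c)

    enabledActions : List A
    enabledActions = filter enabled? (allFin |A|)

    best : A
    best = argmax (backup g u) c₀ enabledActions

    best-enabled : Nonempty (Δ u best)
    best-enabled = argmax-all (backup g u) {P = λ c → Nonempty (Δ u c)} ne₀
      (All.tabulate λ c∈ → proj₂ (∈-filter⁻ enabled? {xs = allFin |A|} c∈))

    best-maximal : ∀ d → backup g u d ≤ backup g u best
    best-maximal d with enabled? d
    ... | yes ne = All.lookup (f[xs]≤f[argmax] c₀ enabledActions) (∈-filter⁺ enabled? (∈-allFin d) ne)
    ... | no ¬ne = ≤-trans (≤-reflexive (backup-disabled ¬ne)) (backup-nonNeg 0≤g u best)

  -- The argument of type `A` is the choice at states where nothing is enabled.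
  greedyStrategy : ∀ {g} → (∀ t → 0# ≤ g t) → A →
    ∃[ σ ] σ ∈ₗ strategies ℝ M × (∀ u c → backup g u c ≤ backup g u (σ u))
  greedyStrategy {g} 0≤g a =
    finToFun i , finToFun∈strategies i isStrategy ,
    λ u c → ≡.subst (λ d → backup g u c ≤ backup g u d) (≡.sym (σ≡ u)) (proj₂ (proj₂ (choice u)) c)
    where
    choice = greedyAction 0≤g a

    -- `strategies` lists decoded numbers, so the choice is encoded first; the decoded function
    -- agrees with it pointwise.
    i : Fin (|A| ^ |S|)
    i = funToFin (proj₁ ∘ choice)

    σ≡ : ∀ u → finToFun i u ≡ proj₁ (choice u)
    σ≡ = finToFun-funToFin (proj₁ ∘ choice)

    isStrategy : IsStrategy ℝ M (finToFun i)
    isStrategy u some = ≡.subst (λ c → Nonempty (Δ u c)) (≡.sym (σ≡ u)) (proj₁ (proj₂ (choice u)) some)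

-- Comparison of the model with and without the pair.

module _ (ℝ : RealField) (M : PMDP) (val : Valuation ℝ M) (s : PMDP.S M) (a : PMDP.A M) where
  open RealField ℝ hiding (zero)
  open OrderedField ℝ
  open PMDP M
  open Valuation val using (prob)

  private
    N    = remove M s a
    val′ = restrict ℝ M s a val
    V    = maxℙ[◇fin] ℝ M val
    V′   = maxℙ[◇fin] ℝ N val′

    module N = PMDP N
    module V′ = Valuation val′

  -- Resolves the conditionals in `remove` and `restrict` together, so that later proofs split on
  -- this sum only.
  remove-cases : ∀ u c →
    ((u ≡ s × c ≡ a) × (∀ {t} → t ∉ N.Δ u c) × (∀ t → V′.prob u c t ≡ 0#)) ⊎
    (N.Δ u c ≡ Δ u c × (∀ t → V′.prob u c t ≡ prob u c t))
  remove-cases u c with u ≟ s | c ≟ a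
  ... | yes u≡s | yes c≡a = inj₁ ((u≡s , c≡a) , ∉⊥ , λ _ → ≡.refl)
  ... | yes _   | no  _   = inj₂ (≡.refl , λ _ → ≡.refl)
  ... | no  _   | _       = inj₂ (≡.refl , λ _ → ≡.refl)

  remove-⊆ : ∀ {u c t} → t ∈ N.Δ u c → t ∈ Δ u c
  remove-⊆ {u} {c} t∈ with remove-cases u c
  ... | inj₁ (_ , t∉ , _) = contradiction t∈ t∉
  ... | inj₂ (Δ≡ , _)     = ≡.subst (_ ∈_) Δ≡ t∈

  enabled⇒Δ≡ : ∀ {u c} → Nonempty (N.Δ u c) → N.Δ u c ≡ Δ u c
  enabled⇒Δ≡ {u} {c} (t , t∈) with remove-cases u c
  ... | inj₁ (_ , t∉ , _) = contradiction t∈ t∉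
  ... | inj₂ (Δ≡ , _)     = Δ≡

  -- The value in `M` is a supersolution for the chain in `N`: a row is either unchanged or zero.
  value-restrict≤ : ∀ σ u →
    ℙ[◇] ℝ (induced ℝ N val′ σ) fin u ≤ ℙ[◇] ℝ (induced ℝ M val σ) fin u
  value-restrict≤ σ = Reachability.ℙ-least ℝ (induced ℝ N val′ σ) fin R.ℙ-nonNeg R.1≤ℙ-goal super
    where
    module R = Reachability ℝ (induced ℝ M val σ) fin
    h = ℙ[◇] ℝ (induced ℝ M val σ) fin

    super : ∀ {u} → u ≢ fin → backup ℝ N val′ h u (σ u) ≤ h u
    super {u} u≢ with remove-cases u (σ u)
    ... | inj₁ (_ , _ , ≡0)    = ≤-trans
      (≤-reflexive (sum-≈0 λ t → trans (*-congʳ (reflexive (≡0 t))) (zeroˡ (h t)))) (R.ℙ-nonNeg u)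
    ... | inj₂ (_ , prob≡) = ≤-trans
      (≤-reflexive (sum-cong-≋ λ t → *-congʳ (reflexive (prob≡ t)))) (R.∑≤ℙ u≢)

  module _ {b} (b≢a : b ≢ a) (b-enabled : Nonempty (Δ s b)) where

    b-kept : N.Δ s b ≡ Δ s b × (∀ t → V′.prob s b t ≡ prob s b t)
    b-kept with remove-cases s b
    ... | inj₁ ((_ , b≡a) , _) = contradiction b≡a b≢a
    ... | inj₂ kept            = kept

    enabled-remove : ∀ {u} → ∃[ c ] Nonempty (Δ u c) → ∃[ c ] Nonempty (N.Δ u c)
    enabled-remove {u} (c , ne) with remove-cases u c
    ... | inj₁ ((≡.refl , _) , _) = b , ≡.subst Nonempty (≡.sym (proj₁ b-kept)) b-enabled
    ... | inj₂ (Δ≡ , _)           = c , ≡.subst Nonempty (≡.sym Δ≡) ne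

    -- As `b` survives at `s`, no state loses its last enabled action, so a strategy of `N` is
    -- constrained wherever one of `M` is.
    strategies-remove-⊆ : ∀ {σ} → σ ∈ₗ strategies ℝ N → σ ∈ₗ strategies ℝ M
    strategies-remove-⊆ σ∈ =
      let σ∈all , strategy = ∈-filter⁻ (isStrategy? ℝ N) {xs = List.map finToFun (allFin (|A| ^ |S|))} σ∈
      in ∈-filter⁺ (isStrategy? ℝ M) σ∈all λ u some →
           let t , t∈ = strategy u (enabled-remove some) in t , remove-⊆ t∈

    maxℙ-remove≤ : ∀ u → V′ u ≤ V u
    maxℙ-remove≤ u = maxℙ≤ ℝ N val′ (maxℙ-nonNeg ℝ M val u) λ {σ} σ∈ →
      ≤-trans (value-restrict≤ σ u) (value≤maxℙ ℝ M val (strategies-remove-⊆ σ∈) u)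

    module _ (no-EC : ∀ {X p} → IsEndComponent M X → ¬ p ∈ Sub.P X)
             (a≤b : backup ℝ M val V s a ≤ backup ℝ M val V s b) where

      -- The removed pair is replaced by `b`, which is no worse for `V`; every other pair keeps its
      -- row.
      backup-replace : ∀ u c → ∃[ d ] backup ℝ M val V u c ≤ backup ℝ N val′ V u d
      backup-replace u c with remove-cases u c
      ... | inj₁ ((≡.refl , ≡.refl) , _) = b , ≤-trans a≤b
        (≤-reflexive (sum-cong-≋ λ t → *-congʳ (reflexive (≡.sym (proj₂ b-kept t)))))
      ... | inj₂ (_ , prob≡) = c ,
        ≤-reflexive (sum-cong-≋ λ t → *-congʳ (reflexive (≡.sym (prob≡ t))))

      -- A row of `N` summing to 1 is a row of `M`, so a trap in `N` is closed in `M` as well and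
      -- would yield an end component.
      no-trap : ∀ σ (Q : Pred S 0ℓ) →
        (∀ {u} → Q u → ∑[ t < |S| ] V′.prob u (σ u) t ≈ 1#) →
        (∀ {u t} → Q u → 0# < V′.prob u (σ u) t → Q t) → ∀ u → ¬ Q u
      no-trap σ Q row closed u q = closed⇒¬¬EC M σ {Q}
        (λ q → let t , t∈ = enabled q in t , remove-⊆ t∈)
        (λ q t∈ → closed q (V′.positive (≡.subst (_ ∈_) (≡.sym (enabled⇒Δ≡ (enabled q))) t∈)))
        q λ (X , ecX , p , p∈X) → no-EC ecX p∈X
        where
        enabled : ∀ {u} → Q u → Nonempty (N.Δ u (σ u))
        enabled q = row≈1⇒enabled ℝ N val′ (row q)

      maxℙ≤remove : ∀ u → V u ≤ V′ u
      maxℙ≤remove u =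
        -- The strategy lives in `N` but is greedy for the value `V` of `M`, the function to be
        -- shown subharmonic.
        let σ , σ∈ , greedy = greedyStrategy ℝ N val′ (maxℙ-nonNeg ℝ M val) a
        in ≤-trans
          (Reachability.subharmonic≤ℙ ℝ (induced ℝ N val′ σ) fin
            (λ Q row closed _ → no-trap σ Q row closed)
            (maxℙ≤1 ℝ M val fin)
            (λ {v} v≢ → maxℙ≤backup ℝ M val v≢
              (backup-nonNeg ℝ N val′ (maxℙ-nonNeg ℝ M val) v (σ v))
              λ c → let d , c≤d = backup-replace v c in ≤-trans c≤d (greedy v d))
            u)
          (value≤maxℙ ℝ N val′ σ∈ u)

theorem6 : (ℝ : RealField) (M : PMDP) → structure M ≅ MEC-quotient M →
    let open RealField ℝ in
    (val : Valuation ℝ M) (s : PMDP.S M) (a : PMDP.A M) →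
    _⊴_ ℝ M (pair s a) (Edge M (state s) ∖ ｛ pair s a ｝) →
    maxℙ[◇fin] ℝ M val s ≈ maxℙ[◇fin] ℝ (remove M s a) (restrict ℝ M s a val) s
theorem6 ℝ M iso val s a sa⊴ with sa⊴ val
-- Edges out of a state lead only to its pairs, so the witness is some `pair s b` with `b` enabled,
-- and its being distinct from `pair s a` gives `b ≢ a`.
... | _ , (choose t∈ _ , ≢sa) , a≤b = RealField.≤-antisym ℝ
  (maxℙ≤remove ℝ M val s a b≢a (_ , t∈) (no-EC M iso) a≤b s)
  (maxℙ-remove≤ ℝ M val s a b≢a (_ , t∈) s)
  where b≢a = λ { ≡.refl → ≢sa ≡.refl }
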